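{- Let $k,s$ be positive integers and let $p_0\geq p_1\geq\cdots\geq p_s>0$ be arbitrary real numbers, $\vec{p}=(p_0,\ldots,p_s)$. Then $$f_{\vec{p}}((s+1)k,k,s)=(p_0+p_1+\cdots+p_s)\binom{(s+1)k-1}{k}.$$
   Context: $[n]=\{1,\ldots,n\}$ and $\binom{[n]}{k}$ is the collection of all $k$-element subsets of $[n]$. For families $\mathcal{A}_1,\ldots,\mathcal{A}_m\subseteq 2^{[n]}$ the rainbow matching number $\nu(\mathcal{A}_1,\ldots,\mathcal{A}_m)$ is the maximum integer $r$ such that there are indices $1\leq i_1<\cdots<i_r\leq m$ and pairwise disjoint sets $A_{i_1}\in\mathcal{A}_{i_1},\ldots,A_{i_r}\in\mathcal{A}_{i_r}$. A sequence of $s+1$ families $\mathcal{B}_0,\mathcal{B}_1,\ldots,\mathcal{B}_s\subseteq 2^{[n]}$ is called overlapping if $\nu(\mathcal{B}_0,\ldots,\mathcal{B}_s)\leq s$, i.e. one cannot choose pairwise disjoint sets $B_i\in\mathcal{B}_i$, $i=0,\ldots,s$. For real constants $p_0\geq p_1\geq\cdots\geq p_s>0$, $\vec{p}=(p_0,\ldots,p_s)$ and $n\geq (s+1)k$, define $$f_{\vec{p}}(n,k,s)=\max\left\{\sum_{i=0}^s p_i|\mathcal{B}_i| : \mathcal{B}_0\subseteq\mathcal{B}_1\subseteq\cdots\subseteq\mathcal{B}_s\subseteq\binom{[n]}{k}\text{ are overlapping}\right\}$$ (families may be empty and may coincide). -}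

module Defs where

open import Algebra.Bundles.Raw using (RawMonoid)
import Algebra.Definitions.RawMonoid as RawMonoidOps
open import Data.Fin.Base as Fin using (Fin; fromℕ)
open import Data.Fin.Subset using (Subset; _∩_; Empty; ∣_∣)
open import Data.List.Base using (List; length)
open import Data.List.Membership.Propositional using (_∈_)
open import Data.List.Relation.Binary.Subset.Propositional using (_⊆_)
open import Data.List.Relation.Unary.Unique.Propositional using (Unique)
open import Data.Nat.Base as ℕ using (ℕ; suc; _⊔_)
import Data.Nat.Properties as ℕ
open import Data.Product.Base using (Σ-syntax; ∃-syntax; _×_; _,_)
open import Data.Rational.Base as ℚ using (ℚ; 0ℚ; ½)
import Data.Rational.Properties as ℚ
open import Data.Rational.Solver using (module +-*-Solver)
open import Level as Level using (0ℓ)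
open import Relation.Binary.Core using (Rel)
open import Relation.Binary.PropositionalEquality
  using (_≡_; _≢_; refl; subst; cong)
open import Relation.Unary using (Pred)

IsMaximum : ∀ {a ℓ p} {A : Set a} → Rel A ℓ → Pred A p → Pred A (a Level.⊔ ℓ Level.⊔ p)
IsMaximum _≤_ P m = P m × (∀ x → P x → x ≤ m)

IsCauchy : (ℕ → ℚ) → Set
IsCauchy x = ∀ ε → 0ℚ ℚ.< ε →
  ∃[ N ] ∀ m n → N ℕ.≤ m → N ℕ.≤ n → ℚ.∣ x m ℚ.- x n ∣ ℚ.≤ ε

-- Elements are representatives: equality of real numbers is _≃_, not _≡_.
record ℝ : Set where
  constructor mkℝ
  field
    seq    : ℕ → ℚ
    cauchy : IsCauchy seq

open ℝ public

infix 4 _≃_ _≤_ _<_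

_≃_ : Rel ℝ 0ℓ
x ≃ y = ∀ ε → 0ℚ ℚ.< ε →
  ∃[ N ] ∀ n → N ℕ.≤ n → ℚ.∣ seq x n ℚ.- seq y n ∣ ℚ.≤ ε

_≤_ : Rel ℝ 0ℓ
x ≤ y = ∀ ε → 0ℚ ℚ.< ε →
  ∃[ N ] ∀ n → N ℕ.≤ n → seq x n ℚ.≤ seq y n ℚ.+ ε

_<_ : Rel ℝ 0ℓ
x < y = ∃[ ε ] 0ℚ ℚ.< ε ×
  (∃[ N ] ∀ n → N ℕ.≤ n → seq x n ℚ.+ ε ℚ.≤ seq y n)

0ℝ : ℝ
0ℝ = mkℝ (λ _ → 0ℚ) λ ε 0<ε → 0 , λ _ _ _ _ → ℚ.<⇒≤ 0<ε

private
  half-pos : ∀ {ε} → 0ℚ ℚ.< ε → 0ℚ ℚ.< ½ ℚ.* ε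
  half-pos {ε} 0<ε = subst (ℚ._< ½ ℚ.* ε) (ℚ.*-zeroʳ ½) (ℚ.*-monoʳ-<-pos ½ 0<ε)

  halves : ∀ ε → ½ ℚ.* ε ℚ.+ ½ ℚ.* ε ≡ ε
  halves = solve 1 (λ e → con ½ :* e :+ con ½ :* e := e) refl
    where open +-*-Solver

  interchange : ∀ a b c d →
    (a ℚ.+ b) ℚ.- (c ℚ.+ d) ≡ (a ℚ.- c) ℚ.+ (b ℚ.- d)
  interchange = solve 4
    (λ a b c d → (a :+ b) :- (c :+ d) := (a :- c) :+ (b :- d)) refl
    where open +-*-Solver

  +-cauchy : ∀ x y → IsCauchy x → IsCauchy y → IsCauchy (λ n → x n ℚ.+ y n)
  +-cauchy x y cx cy ε 0<ε
    with cx (½ ℚ.* ε) (half-pos 0<ε) | cy (½ ℚ.* ε) (half-pos 0<ε)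
  ... | M , hx | N , hy = M ⊔ N , λ m n m≥ n≥ → begin
    ℚ.∣ (x m ℚ.+ y m) ℚ.- (x n ℚ.+ y n) ∣
      ≡⟨ cong ℚ.∣_∣ (interchange (x m) (y m) (x n) (y n)) ⟩
    ℚ.∣ (x m ℚ.- x n) ℚ.+ (y m ℚ.- y n) ∣
      ≤⟨ ℚ.∣p+q∣≤∣p∣+∣q∣ (x m ℚ.- x n) (y m ℚ.- y n) ⟩
    ℚ.∣ x m ℚ.- x n ∣ ℚ.+ ℚ.∣ y m ℚ.- y n ∣
      ≤⟨ ℚ.+-mono-≤ (hx m n (ℕ.m⊔n≤o⇒m≤o M N m≥) (ℕ.m⊔n≤o⇒m≤o M N n≥))
                    (hy m n (ℕ.m⊔n≤o⇒n≤o M N m≥) (ℕ.m⊔n≤o⇒n≤o M N n≥)) ⟩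
    ½ ℚ.* ε ℚ.+ ½ ℚ.* ε
      ≡⟨ halves ε ⟩
    ε ∎
    where open ℚ.≤-Reasoning

infixl 6 _+_

_+_ : ℝ → ℝ → ℝ
x + y = mkℝ (λ n → seq x n ℚ.+ seq y n) (+-cauchy (seq x) (seq y) (cauchy x) (cauchy y))

+-0-rawMonoid : RawMonoid 0ℓ 0ℓ
+-0-rawMonoid = record { Carrier = ℝ ; _≈_ = _≃_ ; _∙_ = _+_ ; ε = 0ℝ }

-- n · x is the n-fold sum x + ⋯ + x, i.e. the product of x with the
-- natural number n; sum p is p₀ + p₁ + ⋯.
open RawMonoidOps +-0-rawMonoid public using (sum) renaming (_×_ to _·_)

-- A finite family is listed without repetition, so that its cardinality is
-- the length of the list; the order of the list plays no role.
record Family (n : ℕ) : Set where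
  constructor mkFamily
  field
    members : List (Subset n)
    unique  : Unique members

open Family public

card : ∀ {n} → Family n → ℕ
card 𝓐 = length (members 𝓐)

_∈ᶠ_ : ∀ {n} → Subset n → Family n → Set
A ∈ᶠ 𝓐 = A ∈ members 𝓐

_⊆ᶠ_ : ∀ {n} → Family n → Family n → Set
𝓐 ⊆ᶠ 𝓑 = members 𝓐 ⊆ members 𝓑

_⊆[_]-sets : ∀ {n} → Family n → ℕ → Set
𝓐 ⊆[ k ]-sets = ∀ A → A ∈ᶠ 𝓐 → ∣ A ∣ ≡ k

record RainbowMatching {n m} (𝓐 : Fin m → Family n) (r : ℕ) : Set where
  field
    index      : Fin r → Fin m
    increasing : ∀ a b → a Fin.< b → index a Fin.< index b
    choice     : Fin r → Subset n
    chosen     : ∀ a → choice a ∈ᶠ 𝓐 (index a)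
    disjoint   : ∀ a b → a ≢ b → Empty (choice a ∩ choice b)

IsRainbowMatchingNumber : ∀ {n m} → (Fin m → Family n) → ℕ → Set
IsRainbowMatchingNumber 𝓐 = IsMaximum ℕ._≤_ (RainbowMatching 𝓐)

Overlapping : ∀ {n} s → (Fin (suc s) → Family n) → Set
Overlapping s 𝓑 = ∃[ ν ] IsRainbowMatchingNumber 𝓑 ν × ν ℕ.≤ s

record Admissible (n k s : ℕ) (𝓑 : Fin (suc s) → Family n) : Set where
  field
    nested      : ∀ i j → i Fin.≤ j → 𝓑 i ⊆ᶠ 𝓑 j
    uniform     : 𝓑 (fromℕ s) ⊆[ k ]-sets
    overlapping : Overlapping s 𝓑

weight : ∀ {n s} → (Fin (suc s) → ℝ) → (Fin (suc s) → Family n) → ℝ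
weight p 𝓑 = sum (λ i → card (𝓑 i) · p i)

-- IsF n k s p v: the maximum defining f_p(n,k,s) exists and equals v.
IsF : (n k s : ℕ) → (Fin (suc s) → ℝ) → ℝ → Set
IsF n k s p = IsMaximum _≤_ λ v →
  Σ[ 𝓑 ∈ (Fin (suc s) → Family n) ] Admissible n k s 𝓑 × weight p 𝓑 ≃ v

{-# OPTIONS --safe #-}
module Submission where

-- The weights decrease and the family sizes increase along a nested chain, so
-- by Chebyshev's sum inequality it suffices to bound Σ |𝓑ᵢ| by
-- (s + 1) · C(n - 1, k). For this, average over all ordered partitions of [n]
-- into s + 1 blocks of size k. For a fixed partition let Nᵢ be the number of
-- blocks in 𝓑ᵢ. If every Nᵢ exceeded i, blocks could be chosen greedily to form
-- a rainbow matching; so some Nᵢ ≤ i, and since N₀ ≤ ⋯ ≤ Nₛ ≤ s + 1 this gives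
-- Σ Nᵢ ≤ (i + 1) i + (s - i)(s + 1) ≤ s (s + 1). Equality holds for the family
-- of all k-sets that avoid a fixed point.

open import Algebra.Bundles using (CommutativeMonoid; RawMonoid)
import Algebra.Definitions.RawMonoid as RawMonoidOps
import Algebra.Properties.CommutativeMonoid.Mult as Mult
open import Algebra.Structures using (IsCommutativeMonoid)
open import Data.Fin.Base as Fin using (Fin; zero; suc; fromℕ)
import Data.Fin.Properties as Fin
open import Data.Nat.Base as ℕ using (ℕ; zero; suc; _*_; _∸_; NonZero; _⊔_)
open import Data.Nat.Combinatorics using (_C_)
import Data.Nat.Properties as ℕ
open import Data.Product.Base using (_×_; _,_; proj₁; proj₂; Σ-syntax; ∃-syntax)
open import Data.Rational.Base as ℚ using (ℚ; 0ℚ; ½)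
import Data.Rational.Properties as ℚ
import Data.Rational.Solver as ℚ
open import Data.Sum.Base using (inj₁; inj₂)
open import Function.Base using (_∘_)
open import Relation.Binary.Bundles using (Preorder)
open import Relation.Binary.Core using (Rel; _Preserves₂_⟶_⟶_)
open import Relation.Binary.PropositionalEquality
  using (_≡_; _≢_; refl; sym; trans; cong; cong₂; subst; subst₂; _≗_)
import Relation.Binary.Reasoning.Preorder as PreorderReasoning
open import Relation.Binary.Structures using (IsPreorder)
open import Relation.Nullary using (Dec; yes; no; does; ¬_; contradiction)

module Counting where

  open import Algebra.Properties.CommutativeMonoid.Sum ℕ.+-0-commutativeMonoid
    using (sum-remove; ∑-distrib-+)
  open import Algebra.Properties.Semiring.Sum ℕ.+-*-semiring public
    using (sum; *-distribʳ-sum)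
  open import Data.Bool.Base using (true; false; if_then_else_)
  import Data.Bool.Properties as Bool
  open import Data.Fin.Base using (toℕ; punchIn)
  open import Data.Fin.Properties using (_≟_; punchInᵢ≢i)
  open import Data.Fin.Subset
  open import Data.Fin.Subset.Properties hiding (_∈?_)
  open import Data.List.Base as List using (List; []; _∷_; length)
  import Data.List.Membership.DecPropositional as DecMembership
  open import Data.List.Membership.Propositional using () renaming (_∈_ to _∈ˡ_)
  open import Data.List.Membership.Propositional.Properties
    using (∈-map⁺; ∈-map⁻; ∈-++⁺ˡ; ∈-++⁺ʳ; ∈-++⁻; ∈-lookup)
  open import Data.List.Properties using (length-map; length-++)
  open import Data.List.Relation.Unary.All as All using ()
  open import Data.List.Relation.Unary.AllPairs using ([]; _∷_)
  open import Data.List.Relation.Unary.Any as Any using (here; there)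
  open import Data.List.Relation.Unary.Any.Properties using (lookup-index)
  open import Data.List.Relation.Unary.Unique.Propositional using (Unique)
  import Data.List.Relation.Unary.Unique.Propositional.Properties as Unique
  open import Data.Nat.Base hiding (∣_-_∣)
  open import Data.Nat.Combinatorics
    using (nCk≡n!/k![n-k]!; k![n∸k]!∣n!; nCk+nC[k+1]≡[n+1]C[k+1])
  open import Data.Nat.DivMod using (_/_; m/n*n≡m)
  open import Data.Nat.Properties hiding (_≟_)
  open import Data.Nat.Tactic.RingSolver using (solve-∀)
  open import Data.Vec.Base as Vec using (Vec; []; _∷_; tabulate; lookup)
  open import Data.Vec.Functional using (updateAt)
  open import Data.Vec.Functional.Properties using (updateAt-updates; updateAt-minimal)
  open import Data.Vec.Properties as Vec using (≡-dec; lookup∘tabulate; []=⇒lookup; lookup-map)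
  open import Defs
    using (Family; mkFamily; members; unique; card; _∈ᶠ_; _⊆ᶠ_; _⊆[_]-sets;
           RainbowMatching; Admissible)
  open import Relation.Binary.Definitions using (DecidableEquality)
  open import Relation.Nullary.Decidable using (dec-true; dec-false)

  private variable
    m n r t : ℕ

  -- Finite sums and cardinalities of subsets.

  term≤sum : ∀ (f : Fin m → ℕ) i → f i ≤ sum f
  term≤sum f zero    = m≤m+n (f zero) _
  term≤sum f (suc i) = ≤-trans (term≤sum (f ∘ suc) i) (m≤n+m _ (f zero))

  sum-mono : ∀ {f g : Fin m → ℕ} → (∀ i → f i ≤ g i) → sum f ≤ sum g
  sum-mono {zero}  f≤g = z≤n
  sum-mono {suc m} f≤g = +-mono-≤ (f≤g zero) (sum-mono (f≤g ∘ suc))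

  sum-const : ∀ m c → sum {m} (λ _ → c) ≡ m * c
  sum-const zero    c = refl
  sum-const (suc m) c = cong (c +_) (sum-const m c)

  ∣p∩q∣+∣p─q∣≡∣p∣ : ∀ (p q : Subset n) → ∣ p ∩ q ∣ + ∣ p ─ q ∣ ≡ ∣ p ∣
  ∣p∩q∣+∣p─q∣≡∣p∣ []            []            = refl
  ∣p∩q∣+∣p─q∣≡∣p∣ (outside ∷ p) (outside ∷ q) = ∣p∩q∣+∣p─q∣≡∣p∣ p q
  ∣p∩q∣+∣p─q∣≡∣p∣ (outside ∷ p) (inside  ∷ q) = ∣p∩q∣+∣p─q∣≡∣p∣ p q
  ∣p∩q∣+∣p─q∣≡∣p∣ (inside  ∷ p) (outside ∷ q) =
    trans (+-suc ∣ p ∩ q ∣ ∣ p ─ q ∣) (cong suc (∣p∩q∣+∣p─q∣≡∣p∣ p q))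
  ∣p∩q∣+∣p─q∣≡∣p∣ (inside  ∷ p) (inside  ∷ q) = cong suc (∣p∩q∣+∣p─q∣≡∣p∣ p q)

  ∣p∣≤1+∣p-x∣ : ∀ (p : Subset n) x → ∣ p ∣ ≤ suc ∣ p - x ∣
  ∣p∣≤1+∣p-x∣ p x = begin
    ∣ p ∣                        ≡⟨ ∣p∩q∣+∣p─q∣≡∣p∣ p ⁅ x ⁆ ⟨
    ∣ p ∩ ⁅ x ⁆ ∣ + ∣ p - x ∣    ≤⟨ +-monoˡ-≤ _ (∣p∩q∣≤∣q∣ p ⁅ x ⁆) ⟩
    ∣ ⁅ x ⁆ ∣ + ∣ p - x ∣        ≡⟨ cong (_+ ∣ p - x ∣) (∣⁅x⁆∣≡1 x) ⟩
    suc ∣ p - x ∣                ∎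
    where open ≤-Reasoning

  0<∣p∣⇒Nonempty : ∀ (p : Subset n) → 0 < ∣ p ∣ → Nonempty p
  0<∣p∣⇒Nonempty {n} p 0<∣p∣ with nonempty? p
  ... | yes ne = ne
  ... | no  em = contradiction
    (subst (0 <_) (trans (cong ∣_∣ (Empty-unique em)) (∣⊥∣≡0 n)) 0<∣p∣) λ()

  -- Otherwise deleting `x` a second time would strictly shrink `p - x`, although deletion is
  -- idempotent.
  x∉p-x : ∀ (p : Subset n) x → x ∉ p - x
  x∉p-x p x x∈p-x =
    <-irrefl (cong ∣_∣ (p─q─q≡p─q p ⁅ x ⁆)) (x∈p⇒∣p-x∣<∣p∣ x∈p-x)

  -- Greedy choice of representatives and packing of disjoint sets.

  -- Representatives are chosen in the order of the index. Deleting the one chosen for `S zero`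
  -- costs each later set at most one element, and shifting the index lowers the required size by
  -- one as well.
  greedy-sdr : ∀ {r m} (S : Fin r → Subset m) → (∀ i → toℕ i < ∣ S i ∣) →
    Σ[ g ∈ (Fin r → Fin m) ] (∀ i → g i ∈ S i) × (∀ i j → g i ≡ g j → i ≡ j)
  greedy-sdr {zero}  {m} S large = (λ ()) , (λ ()) , λ ()
  greedy-sdr {suc r} {m} S large with 0<∣p∣⇒Nonempty (S zero) (large zero)
  ... | x , x∈S₀ with greedy-sdr (λ i → S (suc i) - x)
                        (λ i → s≤s⁻¹ (≤-trans (large (suc i)) (∣p∣≤1+∣p-x∣ (S (suc i)) x)))
  ... | g , g∈S , g-inj = g⁺ , g⁺∈S , g⁺-inj
    where
    g⁺ : Fin (suc r) → Fin m
    g⁺ zero    = x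
    g⁺ (suc i) = g i
    g⁺∈S : ∀ i → g⁺ i ∈ S i
    g⁺∈S zero    = x∈S₀
    g⁺∈S (suc i) = p─q⊆p (S (suc i)) ⁅ x ⁆ (g∈S i)
    x≢g : ∀ i → x ≢ g i
    x≢g i refl = x∉p-x (S (suc i)) x (g∈S i)
    g⁺-inj : ∀ i j → g⁺ i ≡ g⁺ j → i ≡ j
    g⁺-inj zero    zero    eq = refl
    g⁺-inj zero    (suc j) eq = contradiction eq (x≢g j)
    g⁺-inj (suc i) zero    eq = contradiction (sym eq) (x≢g i)
    g⁺-inj (suc i) (suc j) eq = cong suc (g-inj i j eq)

  -- The sets after the first lie in `U ─ A zero`, so the induction runs with the ambient set `U` as
  -- a variable.
  disjoint-packing : ∀ {k} (A : Fin r → Subset n) (U : Subset n) →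
    (∀ a → A a ⊆ U) → (∀ a → ∣ A a ∣ ≡ k) →
    (∀ a b → a ≢ b → Empty (A a ∩ A b)) → r * k ≤ ∣ U ∣
  disjoint-packing {zero}          A U A⊆U ∣A∣≡k disj = z≤n
  disjoint-packing {suc r} {k = k} A U A⊆U ∣A∣≡k disj = begin
    k + r * k                            ≡⟨ cong (_+ r * k) (∣A∣≡k zero) ⟨
    ∣ A zero ∣ + r * k
      ≤⟨ +-mono-≤ (p⊆q⇒∣p∣≤∣q∣ λ x∈A → x∈p∩q⁺ (A⊆U zero x∈A , x∈A))
           (disjoint-packing (A ∘ suc) (U ─ A zero) A⊆U─A₀ (∣A∣≡k ∘ suc)
             λ a b a≢b → disj (suc a) (suc b) (a≢b ∘ Fin.suc-injective)) ⟩
    ∣ U ∩ A zero ∣ + ∣ U ─ A zero ∣      ≡⟨ ∣p∩q∣+∣p─q∣≡∣p∣ U (A zero) ⟩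
    ∣ U ∣                                ∎
    where
    open ≤-Reasoning
    A⊆U─A₀ : ∀ a → A (suc a) ⊆ U ─ A zero
    A⊆U─A₀ a x∈A = x∈p∧x∉q⇒x∈p─q (A⊆U (suc a) x∈A)
      λ x∈A₀ → disj zero (suc a) (λ ()) (_ , x∈p∩q⁺ (x∈A₀ , x∈A))

  -- Ordered partitions as weighted colourings.

  indicator : ∀ {p} {P : Set p} → Dec P → ℕ
  indicator P? = if does P? then 1 else 0

  indicator-mono : ∀ {p q} {P : Set p} {Q : Set q} (P? : Dec P) (Q? : Dec Q) →
    (P → Q) → indicator P? ≤ indicator Q?
  indicator-mono (no _)  Q?      P⇒Q = z≤n
  indicator-mono (yes p) (yes q) P⇒Q = ≤-refl
  indicator-mono (yes p) (no ¬q) P⇒Q = contradiction (P⇒Q p) ¬q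

  _≟ˢ_ : DecidableEquality (Subset n)
  _≟ˢ_ = ≡-dec Bool._≟_

  module _ {n : ℕ} where
    open DecMembership (_≟ˢ_ {n}) public using (_∈?_)

  -- A vector over `Fin t` is read as a colouring of the `n` points. Its colour classes are the
  -- blocks of an ordered partition.
  colourClass : Fin t → Vec (Fin t) n → Subset n
  colourClass j = Vec.map (λ i → does (i ≟ j))

  ∈colourClass⁻ : ∀ (j : Fin t) (c : Vec (Fin t) n) {x} → x ∈ colourClass j c → lookup c x ≡ j
  ∈colourClass⁻ j c {x} x∈
    with lookup c x ≟ j | trans (sym (lookup-map x (λ i → does (i ≟ j)) c)) ([]=⇒lookup x∈)
  ... | yes eq | _ = eq

  -- `pred` leaves a count of 0 at 0; `colouringSum` multiplies that branch by the count itself, so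
  -- it contributes nothing.
  decrement : (Fin t → ℕ) → Fin t → Fin t → ℕ
  decrement μ j = updateAt μ j pred

  -- For μ with sum n, this sums f over the n! ways to fill the n positions with
  -- distinguishable tokens of which μ j have colour j.
  colouringSum : ∀ n → (Fin t → ℕ) → (Vec (Fin t) n → ℕ) → ℕ
  colouringSum zero    μ f = f []
  colouringSum (suc n) μ f =
    sum λ j → μ j * colouringSum n (decrement μ j) (λ c → f (j ∷ c))

  suc-sum-decrement : ∀ (μ : Fin t → ℕ) j → .{{NonZero (μ j)}} →
    suc (sum (decrement μ j)) ≡ sum μ
  suc-sum-decrement μ zero    = cong (_+ sum (μ ∘ suc)) (suc-pred (μ zero))
  suc-sum-decrement μ (suc j) = trans (sym (+-suc (μ zero) _))
    (cong (μ zero +_) (suc-sum-decrement (μ ∘ suc) j))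

  sum-decrement : ∀ (μ : Fin t → ℕ) j → .{{NonZero (μ j)}} →
    sum μ ≡ suc n → sum (decrement μ j) ≡ n
  sum-decrement μ j Σμ = suc-injective (trans (suc-sum-decrement μ j) Σμ)

  -- A branch of coefficient 0 needs no estimate. In every other branch the count is positive, so
  -- `decrement` really lowers the total by one.
  *-monoʳ-≤-nonZero : ∀ c {a b} → (.{{NonZero c}} → a ≤ b) → c * a ≤ c * b
  *-monoʳ-≤-nonZero zero    a≤b = z≤n
  *-monoʳ-≤-nonZero (suc c) a≤b = *-monoʳ-≤ (suc c) a≤b

  colouringSum-mono : ∀ n (μ : Fin t → ℕ) {f g} → (∀ c → f c ≤ g c) →
    colouringSum n μ f ≤ colouringSum n μ g
  colouringSum-mono zero    μ f≤g = f≤g []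
  colouringSum-mono (suc n) μ f≤g = sum-mono λ j →
    *-monoʳ-≤ (μ j) (colouringSum-mono n (decrement μ j) (λ c → f≤g (j ∷ c)))

  colouringSum-+ : ∀ n (μ : Fin t → ℕ) f g →
    colouringSum n μ f + colouringSum n μ g ≤ colouringSum n μ (λ c → f c + g c)
  colouringSum-+ zero    μ f g = ≤-refl
  colouringSum-+ (suc n) μ f g = ≤-trans (≤-reflexive (sym (∑-distrib-+ F G)))
    (sum-mono λ j → ≤-trans (≤-reflexive (sym (*-distribˡ-+ (μ j) _ _)))
      (*-monoʳ-≤ (μ j) (colouringSum-+ n (decrement μ j) _ _)))
    where
    F G : Fin _ → ℕ
    F j = μ j * colouringSum n (decrement μ j) (λ c → f (j ∷ c))
    G j = μ j * colouringSum n (decrement μ j) (λ c → g (j ∷ c))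

  colouringSum-sum : ∀ n (μ : Fin t → ℕ) (f : Fin m → Vec (Fin t) n → ℕ) →
    sum (λ i → colouringSum n μ (f i)) ≤ colouringSum n μ (λ c → sum λ i → f i c)
  colouringSum-sum {m = zero}  n μ f = z≤n
  colouringSum-sum {m = suc m} n μ f = ≤-trans
    (+-monoʳ-≤ (colouringSum n μ (f zero)) (colouringSum-sum n μ (f ∘ suc)))
    (colouringSum-+ n μ (f zero) (λ c → sum λ i → f (suc i) c))

  ∣colourClass∣-∷ : ∀ (μ : Fin t → ℕ) j (c : Vec (Fin t) n) → .{{NonZero (μ j)}} →
    (∀ i → ∣ colourClass i c ∣ ≡ decrement μ j i) → ∀ i → ∣ colourClass i (j ∷ c) ∣ ≡ μ i
  ∣colourClass∣-∷ μ j c sizes i with j ≟ i | sizes i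
  ... | yes refl | size = trans (cong suc (trans size (updateAt-updates j μ))) (suc-pred (μ j))
  ... | no j≢i   | size = trans size (updateAt-minimal i j μ (j≢i ∘ sym))

  -- The weights of all colourings add up to `n !`: each position contributes the factor `sum μ`,
  -- which then drops by one. Colourings with other class sizes have weight 0, so `f` has to be
  -- bounded only where the sizes are given by `μ`.
  colouringSum-bound : ∀ n (μ : Fin t → ℕ) f b → sum μ ≡ n →
    (∀ c → (∀ j → ∣ colourClass j c ∣ ≡ μ j) → f c ≤ b) → colouringSum n μ f ≤ n ! * b
  colouringSum-bound zero μ f b Σμ f≤b = ≤-trans
    (f≤b [] λ j → sym (n≤0⇒n≡0 (subst (μ j ≤_) Σμ (term≤sum μ j))))
    (≤-reflexive (sym (*-identityˡ b)))
  colouringSum-bound (suc n) μ f b Σμ f≤b = begin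
    sum (λ j → μ j * colouringSum n (decrement μ j) (λ c → f (j ∷ c)))
      ≤⟨ sum-mono (λ j → *-monoʳ-≤-nonZero (μ j)
           (colouringSum-bound n (decrement μ j) _ b (sum-decrement μ j Σμ)
             λ c sizes → f≤b (j ∷ c) (∣colourClass∣-∷ μ j c sizes))) ⟩
    sum (λ j → μ j * (n ! * b))  ≡⟨ *-distribʳ-sum (n ! * b) μ ⟨
    sum μ * (n ! * b)            ≡⟨ cong (_* (n ! * b)) Σμ ⟩
    suc n * (n ! * b)            ≡⟨ *-assoc (suc n) (n !) b ⟨
    (suc n) ! * b                ∎
    where open ≤-Reasoning

  ∣p∣+∣∁p∣≡n : ∀ (p : Subset n) → ∣ p ∣ + ∣ ∁ p ∣ ≡ n
  ∣p∣+∣∁p∣≡n p = trans (cong (∣ p ∣ +_) (∣∁p∣≡n∸∣p∣ p)) (m+[n∸m]≡n (∣p∣≤n p))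

  -- The tokens of colour `j` can fill `A` in `∣ A ∣ !` orders, and the remaining tokens can fill
  -- the complement in `∣ ∁ A ∣ !` orders. The induction builds up one of the two factorials at each
  -- position.
  colouringSum-class : ∀ (j : Fin t) (A : Subset n) μ → μ j ≡ ∣ A ∣ → sum μ ≡ n →
    ∣ A ∣ ! * ∣ ∁ A ∣ ! ≤ colouringSum n μ (λ c → indicator (colourClass j c ≟ˢ A))
  colouringSum-class j [] μ μj Σμ = ≤-refl
  colouringSum-class {n = suc n} j (inside ∷ A) μ μj Σμ = begin
    (suc ∣ A ∣) ! * ∣ ∁ A ∣ !        ≡⟨ *-assoc (suc ∣ A ∣) (∣ A ∣ !) (∣ ∁ A ∣ !) ⟩
    suc ∣ A ∣ * (∣ A ∣ ! * ∣ ∁ A ∣ !) ≡⟨ cong (_* (∣ A ∣ ! * ∣ ∁ A ∣ !)) μj ⟨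
    μ j * (∣ A ∣ ! * ∣ ∁ A ∣ !)
      ≤⟨ *-monoʳ-≤-nonZero (μ j) (≤-trans
           (colouringSum-class j A (decrement μ j)
             (trans (updateAt-updates j μ) (cong pred μj)) (sum-decrement μ j Σμ))
           (colouringSum-mono n (decrement μ j) λ c → indicator-mono
             (colourClass j c ≟ˢ A) (colourClass j (j ∷ c) ≟ˢ (inside ∷ A))
             λ { refl → cong (_∷ colourClass j c) (dec-true (j ≟ j) refl) })) ⟩
    μ j * colouringSum n (decrement μ j) (λ c → indicator (colourClass j (j ∷ c) ≟ˢ (inside ∷ A)))
      -- The first point lies in `A`, so only the branch that gives it colour `j` is kept.
      ≤⟨ term≤sum _ j ⟩
    _ ∎
    where open ≤-Reasoning
  colouringSum-class {t = suc t} {n = suc n} j (outside ∷ A) μ μj Σμ = begin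
    ∣ A ∣ ! * (suc ∣ ∁ A ∣) !         ≡⟨ swap (∣ A ∣ !) (suc ∣ ∁ A ∣) (∣ ∁ A ∣ !) ⟩
    -- The first point lies outside `A` and takes a colour other than `j`. The tokens of those
    -- colours number `suc ∣ ∁ A ∣`, the new factor of the second factorial.
    suc ∣ ∁ A ∣ * K                   ≡⟨ cong (_* K) others ⟨
    sum (μ ∘ punchIn j) * K           ≡⟨ *-distribʳ-sum K (μ ∘ punchIn j) ⟩
    sum (λ l → μ (punchIn j l) * K)   ≤⟨ sum-mono (λ l → other≤ (punchIn j l) (punchInᵢ≢i j l)) ⟩
    sum (F ∘ punchIn j)               ≤⟨ m≤n+m _ (F j) ⟩
    F j + sum (F ∘ punchIn j)         ≡⟨ sum-remove F ⟨
    sum F                             ∎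
    where
    open ≤-Reasoning
    K = ∣ A ∣ ! * ∣ ∁ A ∣ !
    F : Fin (suc t) → ℕ
    F i = μ i * colouringSum n (decrement μ i)
      (λ c → indicator (colourClass j (i ∷ c) ≟ˢ (outside ∷ A)))
    swap : ∀ x y z → x * (y * z) ≡ y * (x * z)
    swap = solve-∀
    others : sum (μ ∘ punchIn j) ≡ suc ∣ ∁ A ∣
    others = +-cancelˡ-≡ ∣ A ∣ _ _ (begin-equality
      ∣ A ∣ + sum (μ ∘ punchIn j)  ≡⟨ cong (_+ sum (μ ∘ punchIn j)) μj ⟨
      μ j + sum (μ ∘ punchIn j)    ≡⟨ sum-remove μ ⟨
      sum μ                        ≡⟨ Σμ ⟩
      suc n                        ≡⟨ cong suc (∣p∣+∣∁p∣≡n A) ⟨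
      suc (∣ A ∣ + ∣ ∁ A ∣)        ≡⟨ +-suc ∣ A ∣ ∣ ∁ A ∣ ⟨
      ∣ A ∣ + suc ∣ ∁ A ∣          ∎)
    other≤ : ∀ i → i ≢ j → μ i * K ≤ F i
    other≤ i i≢j = *-monoʳ-≤-nonZero (μ i) (≤-trans
      (colouringSum-class j A (decrement μ i)
        (trans (updateAt-minimal j i μ (i≢j ∘ sym)) μj) (sum-decrement μ i Σμ))
      (colouringSum-mono n (decrement μ i) λ c → indicator-mono
        (colourClass j c ≟ˢ A) (colourClass j (i ∷ c) ≟ˢ (outside ∷ A))
        λ { refl → cong (_∷ colourClass j c) (dec-false (i ≟ j) i≢j) }))

  -- A colour class equals at most one member of a list without repetition, so the contributions
  -- from `colouringSum-class` add up.
  colouringSum-family : ∀ {k} (j : Fin t) (L : List (Subset n)) μ → Unique L →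
    (∀ A → A ∈ˡ L → ∣ A ∣ ≡ k) → μ j ≡ k → sum μ ≡ n →
    length L * (k ! * (n ∸ k) !) ≤ colouringSum n μ (λ c → indicator (colourClass j c ∈? L))
  colouringSum-family j []      μ uniq size μj Σμ = z≤n
  colouringSum-family {n = n} {k = k} j (A ∷ L) μ (A∉L ∷ uniq) size μj Σμ = begin
    k ! * (n ∸ k) ! + length L * (k ! * (n ∸ k) !)
      ≤⟨ +-mono-≤ class-A
           (colouringSum-family j L μ uniq (λ B B∈L → size B (there B∈L)) μj Σμ) ⟩
    colouringSum n μ (λ c → indicator (colourClass j c ≟ˢ A)) +
    colouringSum n μ (λ c → indicator (colourClass j c ∈? L))
      ≤⟨ colouringSum-+ n μ _ _ ⟩
    colouringSum n μ (λ c → indicator (colourClass j c ≟ˢ A) + indicator (colourClass j c ∈? L))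
      ≤⟨ colouringSum-mono n μ (λ c → split (colourClass j c)) ⟩
    colouringSum n μ (λ c → indicator (colourClass j c ∈? (A ∷ L))) ∎
    where
    open ≤-Reasoning
    ∣A∣≡k = size A (here refl)
    class-A : k ! * (n ∸ k) ! ≤ colouringSum n μ (λ c → indicator (colourClass j c ≟ˢ A))
    class-A = subst₂
      (λ a b → a ! * b ! ≤ colouringSum n μ (λ c → indicator (colourClass j c ≟ˢ A)))
      ∣A∣≡k (trans (∣∁p∣≡n∸∣p∣ A) (cong (n ∸_) ∣A∣≡k))
      (colouringSum-class j A μ (trans μj (sym ∣A∣≡k)) Σμ)
    split : ∀ X → indicator (X ≟ˢ A) + indicator (X ∈? L) ≤ indicator (X ∈? (A ∷ L))
    split X with X ≟ˢ A | X ∈? L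
    ... | yes refl | yes X∈L = contradiction refl (All.lookup A∉L X∈L)
    ... | yes X≡A  | no  X∉L = ≤-refl
    ... | no X≢A   | yes X∈L = ≤-refl
    ... | no X≢A   | no  X∉L = z≤n

  -- Counting incidences when there is no system of distinct representatives.

  indicatorSet : ∀ {P : Fin m → Set} → (∀ j → Dec (P j)) → Subset m
  indicatorSet P? = tabulate (does ∘ P?)

  ∣indicatorSet∣ : ∀ {m} {P : Fin m → Set} (P? : ∀ j → Dec (P j)) →
    ∣ indicatorSet P? ∣ ≡ sum (indicator ∘ P?)
  ∣indicatorSet∣ {zero}  P? = refl
  ∣indicatorSet∣ {suc m} P? with does (P? zero)
  ... | true  = cong suc (∣indicatorSet∣ (P? ∘ suc))
  ... | false = ∣indicatorSet∣ (P? ∘ suc)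

  ∈indicatorSet⁻ : ∀ {m} {P : Fin m → Set} (P? : ∀ j → Dec (P j)) {j} → j ∈ indicatorSet P? → P j
  ∈indicatorSet⁻ P? {j} j∈ with P? j | trans (sym (lookup∘tabulate (does ∘ P?) j)) ([]=⇒lookup j∈)
  ... | yes p | _ = p

  -- The terms up to `i` are estimated by `u` and the later ones by `v`. Adding `suc (toℕ i) * v` on
  -- the left avoids a truncated subtraction on the right.
  sum-initial-bound : ∀ {m} (a : Fin m → ℕ) (i : Fin m) u v →
    (∀ j → j Fin.≤ i → a j ≤ u) → (∀ j → a j ≤ v) →
    sum a + suc (toℕ i) * v ≤ suc (toℕ i) * u + m * v
  sum-initial-bound {suc m} a zero u v a≤u a≤v = begin
    a zero + sum (a ∘ suc) + 1 * v  ≤⟨ +-monoˡ-≤ (1 * v) (+-mono-≤ (a≤u zero z≤n)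
      (≤-trans (sum-mono (a≤v ∘ suc)) (≤-reflexive (sum-const m v)))) ⟩
    u + m * v + 1 * v               ≡⟨ rearrange u v (m * v) ⟩
    1 * u + (v + m * v)             ∎
    where
    open ≤-Reasoning
    rearrange : ∀ u v w → u + w + 1 * v ≡ 1 * u + (v + w)
    rearrange = solve-∀
  sum-initial-bound {suc m} a (suc i) u v a≤u a≤v = begin
    a zero + sum (a ∘ suc) + (v + suc (toℕ i) * v)
      ≡⟨ rearrange (a zero) (sum (a ∘ suc)) v (suc (toℕ i) * v) ⟩
    a zero + v + (sum (a ∘ suc) + suc (toℕ i) * v)
      ≤⟨ +-mono-≤ (+-monoˡ-≤ v (a≤u zero z≤n))
           (sum-initial-bound (a ∘ suc) i u v (λ j j≤i → a≤u (suc j) (s≤s j≤i)) (a≤v ∘ suc)) ⟩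
    u + v + (suc (toℕ i) * u + m * v)
      ≡⟨ rearrange u v (suc (toℕ i) * u) (m * v) ⟩
    (u + suc (toℕ i) * u) + (v + m * v) ∎
    where
    open ≤-Reasoning
    rearrange : ∀ a b c d → a + b + (c + d) ≡ a + c + (b + d)
    rearrange = solve-∀

  -- By `greedy-sdr`, some row `i` has at most `i` entries. Monotonicity passes this bound to all
  -- earlier rows, and every later row has at most `s + 1` entries.
  no-sdr⇒incidences≤ : ∀ s {P : Fin (suc s) → Fin (suc s) → Set} (P? : ∀ i j → Dec (P i j)) →
    (∀ i i′ j → i Fin.≤ i′ → P i j → P i′ j) →
    ¬ (Σ[ g ∈ (Fin (suc s) → Fin (suc s)) ] (∀ i → P i (g i)) × (∀ i j → g i ≡ g j → i ≡ j)) →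
    sum (λ i → sum (λ j → indicator (P? i j))) ≤ suc s * s
  no-sdr⇒incidences≤ s {P} P? P↑ no-sdr with Fin.any? (λ i → ∣ indicatorSet (P? i) ∣ ℕ.≤? toℕ i)
  ... | no all-large = contradiction
    (let g , g∈ , g-inj = greedy-sdr (λ i → indicatorSet (P? i))
                            (λ i → ≰⇒> λ small → all-large (i , small))
     in g , (λ i → ∈indicatorSet⁻ (P? i) (g∈ i)) , g-inj) no-sdr
  ... | yes (i , small) = +-cancelʳ-≤ (suc (toℕ i) * suc s) _ _ (begin
    sum N + suc (toℕ i) * suc s
      ≤⟨ sum-initial-bound N i (toℕ i) (suc s) N≤i N≤1+s ⟩
    suc (toℕ i) * toℕ i + suc s * suc s
      -- With `d` = `s - i`, the product `i * d` is exactly the amount by which `(s + 1) s` exceeds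
      -- `(i + 1) i + (s - i)(s + 1)`.
      ≤⟨ m≤m+n _ (toℕ i * d) ⟩
    suc (toℕ i) * toℕ i + suc s * suc s + toℕ i * d
      ≡⟨ cong (λ s → suc (toℕ i) * toℕ i + suc s * suc s + toℕ i * d) s≡i+d ⟩
    suc (toℕ i) * toℕ i + suc (toℕ i + d) * suc (toℕ i + d) + toℕ i * d
      ≡⟨ rearrange (toℕ i) d ⟩
    suc (toℕ i + d) * (toℕ i + d) + suc (toℕ i) * suc (toℕ i + d)
      ≡⟨ cong (λ s → suc s * s + suc (toℕ i) * suc s) s≡i+d ⟨
    suc s * s + suc (toℕ i) * suc s ∎)
    where
    open ≤-Reasoning
    N : Fin (suc s) → ℕ
    N i = sum (λ j → indicator (P? i j))
    d = s ∸ toℕ i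
    s≡i+d : s ≡ toℕ i + d
    s≡i+d = sym (m+[n∸m]≡n (Fin.toℕ≤pred[n] i))
    N≤1+s : ∀ j → N j ≤ suc s
    N≤1+s j = subst (_≤ suc s) (∣indicatorSet∣ (P? j)) (∣p∣≤n (indicatorSet (P? j)))
    N≤i : ∀ j → j Fin.≤ i → N j ≤ toℕ i
    N≤i j j≤i = ≤-trans (sum-mono λ l → indicator-mono (P? j l) (P? i l) (P↑ j i l j≤i))
      (subst (_≤ toℕ i) (∣indicatorSet∣ (P? i)) small)
    rearrange : ∀ i d → suc i * i + suc (i + d) * suc (i + d) + i * d
      ≡ suc (i + d) * (i + d) + suc i * suc (i + d)
    rearrange = solve-∀

  -- Enumeration of the k-subsets, and a partition into intervals.

  kSubsets : ∀ n → ℕ → List (Subset n)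
  kSubsets zero    zero    = [] ∷ []
  kSubsets zero    (suc k) = []
  kSubsets (suc n) zero    = List.map (outside ∷_) (kSubsets n zero)
  kSubsets (suc n) (suc k) =
    List.map (inside ∷_) (kSubsets n k) List.++ List.map (outside ∷_) (kSubsets n (suc k))

  -- Splitting by whether the first point is taken turns the recursion of `kSubsets` into Pascal's
  -- rule.
  length-kSubsets : ∀ n k → length (kSubsets n k) ≡ n C k
  length-kSubsets zero    zero    = refl
  length-kSubsets zero    (suc k) = refl
  length-kSubsets (suc n) zero    = trans
    (length-map (outside ∷_) (kSubsets n zero)) (length-kSubsets n zero)
  length-kSubsets (suc n) (suc k) = trans
    (length-++ (List.map (inside ∷_) (kSubsets n k)))
    (trans (cong₂ _+_
      (trans (length-map (inside ∷_) (kSubsets n k)) (length-kSubsets n k))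
      (trans (length-map (outside ∷_) (kSubsets n (suc k))) (length-kSubsets n (suc k))))
      (nCk+nC[k+1]≡[n+1]C[k+1] n k))

  ∈-kSubsets⁺ : ∀ {n} k (A : Subset n) → ∣ A ∣ ≡ k → A ∈ˡ kSubsets n k
  ∈-kSubsets⁺ zero    []            size = here refl
  ∈-kSubsets⁺ zero    (outside ∷ A) size = ∈-map⁺ (outside ∷_) (∈-kSubsets⁺ zero A size)
  ∈-kSubsets⁺ {suc n} (suc k) (inside ∷ A)  size =
    ∈-++⁺ˡ (∈-map⁺ (inside ∷_) (∈-kSubsets⁺ k A (suc-injective size)))
  ∈-kSubsets⁺ {suc n} (suc k) (outside ∷ A) size =
    ∈-++⁺ʳ (List.map (inside ∷_) (kSubsets n k)) (∈-map⁺ (outside ∷_) (∈-kSubsets⁺ (suc k) A size))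

  ∈-kSubsets⁻ : ∀ n k {A} → A ∈ˡ kSubsets n k → ∣ A ∣ ≡ k
  ∈-kSubsets⁻ zero    zero    (here refl) = refl
  ∈-kSubsets⁻ (suc n) zero    A∈ with ∈-map⁻ (outside ∷_) A∈
  ... | B , B∈ , refl = ∈-kSubsets⁻ n zero B∈
  ∈-kSubsets⁻ (suc n) (suc k) A∈ with ∈-++⁻ (List.map (inside ∷_) (kSubsets n k)) A∈
  ... | inj₁ A∈ˡ with ∈-map⁻ (inside ∷_) A∈ˡ
  ... | B , B∈ , refl = cong suc (∈-kSubsets⁻ n k B∈)
  ∈-kSubsets⁻ (suc n) (suc k) A∈ | inj₂ A∈ʳ with ∈-map⁻ (outside ∷_) A∈ʳ
  ... | B , B∈ , refl = ∈-kSubsets⁻ n (suc k) B∈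

  kSubsets-unique : ∀ n k → Unique (kSubsets n k)
  kSubsets-unique zero    zero    = All.[] ∷ []
  kSubsets-unique zero    (suc k) = []
  kSubsets-unique (suc n) zero    = Unique.map⁺ Vec.∷-injectiveʳ (kSubsets-unique n zero)
  kSubsets-unique (suc n) (suc k) = Unique.++⁺
    (Unique.map⁺ Vec.∷-injectiveʳ (kSubsets-unique n k))
    (Unique.map⁺ Vec.∷-injectiveʳ (kSubsets-unique n (suc k)))
    λ (A∈ˡ , A∈ʳ) → heads-differ (∈-map⁻ (inside ∷_) A∈ˡ) (∈-map⁻ (outside ∷_) A∈ʳ)
    where
    heads-differ : ∀ {A} → (∃[ B ] B ∈ˡ kSubsets n k × A ≡ inside ∷ B) →
      ¬ (∃[ B ] B ∈ˡ kSubsets n (suc k) × A ≡ outside ∷ B)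
    heads-differ (_ , _ , refl) (_ , _ , ())

  -- Consecutive blocks of length `k`; all but the first of them will form a matching in the
  -- extremal family.
  intervals : ∀ s k → Fin s → Subset (s * k)
  intervals (suc s) k zero    = ⊤ {k} Vec.++ ⊥
  intervals (suc s) k (suc a) = ⊥ {k} Vec.++ intervals s k a

  ∣p++q∣≡∣p∣+∣q∣ : ∀ (p : Subset m) (q : Subset n) → ∣ p Vec.++ q ∣ ≡ ∣ p ∣ + ∣ q ∣
  ∣p++q∣≡∣p∣+∣q∣ []            q = refl
  ∣p++q∣≡∣p∣+∣q∣ (inside  ∷ p) q = cong suc (∣p++q∣≡∣p∣+∣q∣ p q)
  ∣p++q∣≡∣p∣+∣q∣ (outside ∷ p) q = ∣p++q∣≡∣p∣+∣q∣ p q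

  ∣intervals∣ : ∀ s k a → ∣ intervals s k a ∣ ≡ k
  ∣intervals∣ (suc s) k zero    = trans (∣p++q∣≡∣p∣+∣q∣ (⊤ {k}) ⊥)
    (trans (cong₂ _+_ (∣⊤∣≡n k) (∣⊥∣≡0 (s * k))) (+-identityʳ k))
  ∣intervals∣ (suc s) k (suc a) = trans (∣p++q∣≡∣p∣+∣q∣ (⊥ {k}) (intervals s k a))
    (cong₂ _+_ (∣⊥∣≡0 k) (∣intervals∣ s k a))

  ++-disjoint : ∀ (p q : Subset m) (p′ q′ : Subset n) →
    Empty (p ∩ q) → Empty (p′ ∩ q′) → Empty ((p Vec.++ p′) ∩ (q Vec.++ q′))
  ++-disjoint []      []      p′ q′ pq=∅ p′q′=∅ = p′q′=∅
  ++-disjoint (x ∷ p) (y ∷ q) p′ q′ pq=∅ p′q′=∅ (zero  , here≡) =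
    pq=∅ (zero , Vec.lookup⇒[]= zero ((x ∷ p) ∩ (y ∷ q)) (Vec.[]=⇒lookup here≡))
  ++-disjoint (x ∷ p) (y ∷ q) p′ q′ pq=∅ p′q′=∅ (suc i , Vec.there i∈) =
    ++-disjoint p q p′ q′ (λ (i , i∈) → pq=∅ (suc i , Vec.there i∈)) p′q′=∅ (i , i∈)

  intervals-disjoint : ∀ s k a b → a ≢ b → Empty (intervals s k a ∩ intervals s k b)
  intervals-disjoint (suc s) k zero    zero    a≢b = contradiction refl a≢b
  intervals-disjoint (suc s) k zero    (suc b) a≢b = ++-disjoint (⊤ {k}) ⊥ ⊥ (intervals s k b)
    (λ (_ , x∈) → ∉⊥ (proj₂ (x∈p∩q⁻ ⊤ ⊥ x∈))) (λ (_ , x∈) → ∉⊥ (proj₁ (x∈p∩q⁻ ⊥ _ x∈)))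
  intervals-disjoint (suc s) k (suc a) zero    a≢b = ++-disjoint (⊥ {k}) ⊤ (intervals s k a) ⊥
    (λ (_ , x∈) → ∉⊥ (proj₁ (x∈p∩q⁻ ⊥ ⊤ x∈))) (λ (_ , x∈) → ∉⊥ (proj₂ (x∈p∩q⁻ _ ⊥ x∈)))
  intervals-disjoint (suc s) k (suc a) (suc b) a≢b = ++-disjoint
    (⊥ {k}) ⊥ (intervals s k a) (intervals s k b)
    (λ (_ , x∈) → ∉⊥ (proj₁ (x∈p∩q⁻ ⊥ ⊥ x∈))) (intervals-disjoint s k a b (a≢b ∘ cong suc))

  -- Averaging over ordered partitions.

  [k+q]Ck*k!*q!≡[k+q]! : ∀ k q → ((k + q) C k) * (k ! * q !) ≡ (k + q) !
  [k+q]Ck*k!*q!≡[k+q]! k q = begin-equality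
    ((k + q) C k) * (k ! * q !)
      ≡⟨ cong (λ r → ((k + q) C k) * (k ! * r !)) (m+n∸m≡n k q) ⟨
    ((k + q) C k) * (k ! * (k + q ∸ k) !)
      ≡⟨ cong (_* (k ! * (k + q ∸ k) !)) (nCk≡n!/k![n-k]! (m≤m+n k q)) ⟩
    ((k + q) ! / (k ! * (k + q ∸ k) !)) * (k ! * (k + q ∸ k) !)
      ≡⟨ m/n*n≡m (k![n∸k]!∣n! (m≤m+n k q)) ⟩
    (k + q) ! ∎
    where
    open ≤-Reasoning
    instance _ = k !* (k + q ∸ k) !≢0

  -- Put `n` = `(s + 1) k`. Then `n !` = `n * (n - 1) !`, where `(n - 1) !` = `c * (k ! * q !)`, and
  -- `(n - k) !` = `s * k * q !`. Both sides therefore share the positive factor `Z`.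
  cancel-factorials : ∀ k s .{{_ : NonZero k}} .{{_ : NonZero s}} x →
    x * (suc s * (k ! * (suc s * k ∸ k) !)) ≤ (suc s * k) ! * (suc s * s) →
    x ≤ suc s * ((suc s * k ∸ 1) C k)
  cancel-factorials k@(suc k′) s@(suc s′) x x*z≤ = *-cancelʳ-≤ x (suc s * c) Z (begin
    x * Z                                         ≡⟨ cong (x *_) Z≡ ⟩
    x * (suc s * (k ! * (suc s * k ∸ k) !))       ≤⟨ x*z≤ ⟩
    (suc s * k) ! * (suc s * s)
      ≡⟨ cong (λ f → suc s * k * f * (suc s * s)) [n-1]! ⟨
    suc s * k * (c * (k ! * q !)) * (suc s * s)   ≡⟨ rearrange (suc s) k c (k !) (q !) s ⟩
    suc s * c * Z                                 ∎)
    where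
    open ≤-Reasoning
    -- This is `s * k - 1`, so `k + q` is `n - 1` and `s * k * q !` computes to `(s * k) !`.
    q = k′ + s′ * k
    c = (suc s * k ∸ 1) C k
    Z = suc s * (k ! * (s * k * q !))
    instance
      k!≢0 = k !≢0
      q!≢0 = q !≢0
      s*k*q!≢0 = m*n≢0 (s * k) (q !)
      k!*s*k*q!≢0 = m*n≢0 (k !) (s * k * q !)
      Z≢0 = m*n≢0 (suc s) (k ! * (s * k * q !))
    Z≡ : Z ≡ suc s * (k ! * (suc s * k ∸ k) !)
    Z≡ = cong (λ r → suc s * (k ! * r !)) (sym (m+n∸m≡n k (s * k)))
    [n-1]! : c * (k ! * q !) ≡ (k′ + s * k) !
    [n-1]! = subst (λ r → (r C k) * (k ! * q !) ≡ r !) (sym (+-suc k′ q)) ([k+q]Ck*k!*q!≡[k+q]! k q)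
    rearrange : ∀ S k c f g s → S * k * (c * (f * g)) * (S * s) ≡ S * c * (S * (f * (s * k * g)))
    rearrange = solve-∀

  -- Incidences between a family `𝓑 i`, a colour `j` and a filling are counted twice. Each member of
  -- `𝓑 i` is class `j` in at least `z` fillings, for each of the `s + 1` colours. Each of the `n !`
  -- fillings has at most `(s + 1) s` incidences, since a system of distinct representatives would
  -- be a rainbow matching.
  Σcard-bound : ∀ k s .{{_ : NonZero k}} .{{_ : NonZero s}} (𝓑 : Fin (suc s) → Family (suc s * k)) →
    (∀ i j → i Fin.≤ j → 𝓑 i ⊆ᶠ 𝓑 j) → 𝓑 (fromℕ s) ⊆[ k ]-sets →
    ¬ RainbowMatching 𝓑 (suc s) →
    sum (λ i → card (𝓑 i)) ≤ suc s * ((suc s * k ∸ 1) C k)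
  Σcard-bound k s 𝓑 nested uniform no-rainbow = cancel-factorials k s _ (begin
    sum (λ i → card (𝓑 i)) * (suc s * z)
      ≡⟨ *-distribʳ-sum (suc s * z) (λ i → card (𝓑 i)) ⟩
    sum (λ i → card (𝓑 i) * (suc s * z))
      ≤⟨ sum-mono (λ i → ≤-trans (≤-reflexive (trans (swap (card (𝓑 i)) (suc s) z)
            (sym (sum-const (suc s) (card (𝓑 i) * z)))))
          (sum-mono λ j → colouringSum-family j (members (𝓑 i)) μ (unique (𝓑 i))
            (λ A A∈ → uniform A (nested i (fromℕ s) (Fin.≤fromℕ i) A∈)) refl Σμ)) ⟩
    sum (λ i → sum (λ j → colouringSum (suc s * k) μ (λ c → I i j c)))
      ≤⟨ sum-mono (λ i → colouringSum-sum (suc s * k) μ (I i)) ⟩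
    sum (λ i → colouringSum (suc s * k) μ (λ c → sum (λ j → I i j c)))
      ≤⟨ colouringSum-sum (suc s * k) μ (λ i c → sum (λ j → I i j c)) ⟩
    colouringSum (suc s * k) μ (λ c → sum (λ i → sum (λ j → I i j c)))
      ≤⟨ colouringSum-bound (suc s * k) μ _ (suc s * s) Σμ (λ c _ →
           no-sdr⇒incidences≤ s (λ i j → colourClass j c ∈? members (𝓑 i))
             (λ i i′ j i≤i′ → nested i i′ i≤i′)
             (λ sdr → no-rainbow (sdr⇒rainbow c sdr))) ⟩
    (suc s * k) ! * (suc s * s) ∎)
    where
    open ≤-Reasoning
    z = k ! * (suc s * k ∸ k) !
    -- With `k` tokens of every colour, the weighted colourings are the partitions into `s + 1`
    -- blocks of size `k`.
    μ : Fin (suc s) → ℕ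
    μ _ = k
    Σμ : sum μ ≡ suc s * k
    Σμ = sum-const (suc s) k
    I : Fin (suc s) → Fin (suc s) → Vec (Fin (suc s)) (suc s * k) → ℕ
    I i j c = indicator (colourClass j c ∈? members (𝓑 i))
    swap : ∀ a b c → a * (b * c) ≡ b * (a * c)
    swap = solve-∀
    sdr⇒rainbow : ∀ c → Σ[ g ∈ (Fin (suc s) → Fin (suc s)) ]
      (∀ i → colourClass (g i) c ∈ˡ members (𝓑 i)) × (∀ i j → g i ≡ g j → i ≡ j) →
      RainbowMatching 𝓑 (suc s)
    -- All `s + 1` families take part, so the index map is the identity. Distinct colours have
    -- disjoint classes because a point has only one colour.
    sdr⇒rainbow c (g , g∈ , g-inj) = record
      { index      = λ i → i
      ; increasing = λ _ _ a<b → a<b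
      ; choice     = λ i → colourClass (g i) c
      ; chosen     = g∈
      ; disjoint   = λ a b a≢b (x , x∈) → let x∈a , x∈b = x∈p∩q⁻ _ _ x∈ in
          a≢b (g-inj a b (trans (sym (∈colourClass⁻ (g a) c x∈a)) (∈colourClass⁻ (g b) c x∈b)))
      }

  -- Monotonicity of cardinality, and the extremal family.

  lookup-injective : ∀ {a} {A : Set a} {xs : List A} → Unique xs →
    ∀ {i j} → List.lookup xs i ≡ List.lookup xs j → i ≡ j
  lookup-injective (x∉xs ∷ uniq) {zero}  {zero}  eq = refl
  lookup-injective (x∉xs ∷ uniq) {zero}  {suc j} eq =
    contradiction eq (All.lookup x∉xs (∈-lookup j))
  lookup-injective (x∉xs ∷ uniq) {suc i} {zero}  eq =
    contradiction (sym eq) (All.lookup x∉xs (∈-lookup i))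
  lookup-injective (x∉xs ∷ uniq) {suc i} {suc j} eq = cong suc (lookup-injective uniq eq)

  -- Sending a position in `𝓐` to a position of the same set in `𝓑` is injective, because `𝓐` has no
  -- repetitions.
  card-mono : ∀ (𝓐 𝓑 : Family n) → 𝓐 ⊆ᶠ 𝓑 → card 𝓐 ≤ card 𝓑
  card-mono 𝓐 𝓑 𝓐⊆𝓑 = Fin.injective⇒≤ {f = λ i → Any.index (𝓐⊆𝓑 (∈-lookup i))} λ {i} {j} eq →
    lookup-injective (unique 𝓐) (trans (lookup-index (𝓐⊆𝓑 (∈-lookup i)))
      (trans (cong (List.lookup (members 𝓑)) eq) (sym (lookup-index (𝓐⊆𝓑 (∈-lookup j))))))

  avoidingFirst : ∀ n k → Family (suc n)
  avoidingFirst n k = mkFamily (List.map (outside ∷_) (kSubsets n k))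
    (Unique.map⁺ Vec.∷-injectiveʳ (kSubsets-unique n k))

  card-avoidingFirst : ∀ n k → card (avoidingFirst n k) ≡ n C k
  card-avoidingFirst n k = trans (length-map (outside ∷_) (kSubsets n k)) (length-kSubsets n k)

  ∈-avoidingFirst⁻ : ∀ n k {A} → A ∈ᶠ avoidingFirst n k → ∃[ B ] A ≡ outside ∷ B × ∣ B ∣ ≡ k
  ∈-avoidingFirst⁻ n k A∈ with ∈-map⁻ (outside ∷_) A∈
  ... | B , B∈ , A≡ = B , A≡ , ∈-kSubsets⁻ n k B∈

  -- The members live on the `(s + 1) k - 1` points other than the first, which is too few for
  -- `s + 1` disjoint k-sets. Writing `k` as `suc k′` makes `suc s * k` compute to a successor,
  -- which exhibits the first point.
  avoidingFirst-admissible : ∀ k′ s → let k = suc k′ in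
    Admissible (suc s * k) k s (λ _ → avoidingFirst (k′ + s * k) k)
  avoidingFirst-admissible k′ s = record
    { nested      = λ _ _ _ A∈ → A∈
    ; uniform     = λ A A∈ → let B , A≡ , size = ∈-avoidingFirst⁻ _ k A∈ in trans (cong ∣_∣ A≡) size
    ; overlapping = s , (matching , maximal) , ≤-refl
    }
    where
    k = suc k′
    n⁻ = k′ + s * k
    matching : RainbowMatching (λ (_ : Fin (suc s)) → avoidingFirst n⁻ k) s
    matching = record
      { index      = Fin.inject₁
      ; increasing = λ a b a<b → subst₂ _<_ (sym (Fin.toℕ-inject₁ a)) (sym (Fin.toℕ-inject₁ b)) a<b
      -- Interval `zero` contains the first point and is skipped; the other `s` intervals avoid it.
      ; choice     = λ a → intervals (suc s) k (suc a)
      ; chosen     = λ a → ∈-map⁺ (outside ∷_) (∈-kSubsets⁺ k _ (∣intervals∣ (suc s) k (suc a)))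
      ; disjoint   = λ a b a≢b →
          intervals-disjoint (suc s) k (suc a) (suc b) (a≢b ∘ Fin.suc-injective)
      }
    maximal : ∀ r → RainbowMatching (λ (_ : Fin (suc s)) → avoidingFirst n⁻ k) r → r ≤ s
    -- Packing the tails gives `r * k ≤ n⁻`, and `suc n⁻` is `suc s * k`; hence `r < suc s`.
    maximal r M = s≤s⁻¹ (*-cancelʳ-< k r (suc s) (s≤s (subst (r * k ≤_) (∣⊤∣≡n n⁻)
      (disjoint-packing tail ⊤ (λ _ _ → ∈⊤) (λ a → proj₂ (proj₂ (tail-spec a)))
        λ a b a≢b (x , x∈) → disjoint a b a≢b
          (suc x , subst₂ (λ A B → suc x ∈ A ∩ B) (sym (choice≡ a)) (sym (choice≡ b))
            (Vec.there x∈))))))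
      where
      open RainbowMatching M
      tail-spec : ∀ a → ∃[ B ] choice a ≡ outside ∷ B × ∣ B ∣ ≡ k
      tail-spec a = ∈-avoidingFirst⁻ n⁻ k (chosen a)
      tail : Fin r → Subset n⁻
      tail a = proj₁ (tail-spec a)
      choice≡ : ∀ a → choice a ≡ outside ∷ tail a
      choice≡ a = proj₁ (proj₂ (tail-spec a))

-- Chebyshev's sum inequality over an ordered commutative monoid.

sum-≥ : ∀ {m} (a : Fin m → ℕ) l → (∀ i → l ℕ.≤ a i) → m * l ℕ.≤ Counting.sum a
sum-≥ {zero}  a l l≤a = ℕ.z≤n
sum-≥ {suc m} a l l≤a = ℕ.+-mono-≤ (l≤a zero) (sum-≥ (a ∘ suc) l (l≤a ∘ suc))

-- `a zero` is the least term, so every term exceeds `e + c`. In contrapositive form this keeps the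
-- head within `e + c` in `chebyshev-slack`.
head-excess⇒sum-excess : ∀ {m} (a : Fin (suc m) → ℕ) c e →
  (∀ i j → i Fin.≤ j → a i ℕ.≤ a j) → e ℕ.+ c ℕ.< a zero →
  e ℕ.+ suc m * c ℕ.< Counting.sum a
head-excess⇒sum-excess {m} a c e a↑ e+c<a₀ = begin-strict
  e ℕ.+ (c ℕ.+ m * c)       ≡⟨ ℕ.+-assoc e c (m * c) ⟨
  e ℕ.+ c ℕ.+ m * c         ≤⟨ ℕ.+-monoʳ-≤ (e ℕ.+ c) (ℕ.*-monoʳ-≤ m (ℕ.m≤n+m c e)) ⟩
  e ℕ.+ c ℕ.+ m * (e ℕ.+ c) <⟨ ℕ.+-mono-<-≤ e+c<a₀ (ℕ.*-monoʳ-≤ m (ℕ.<⇒≤ e+c<a₀)) ⟩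
  suc m * a zero            ≤⟨ sum-≥ a (a zero) (λ i → a↑ zero i ℕ.z≤n) ⟩
  Counting.sum a            ∎
  where open ℕ.≤-Reasoning

-- The weights are multiplied only by natural numbers, that is, added repeatedly. Addition and a
-- compatible preorder thus suffice to state and prove the inequality.
module OrderedMonoid {a ℓ₁ ℓ₂} (M : RawMonoid a ℓ₁)
  (isCommutativeMonoid :
    IsCommutativeMonoid (RawMonoid._≈_ M) (RawMonoid._∙_ M) (RawMonoid.ε M))
  (_≤_ : Rel (RawMonoid.Carrier M) ℓ₂)
  (isPreorder : IsPreorder (RawMonoid._≈_ M) _≤_)
  (+-mono : ∀ x y u v → x ≤ y → u ≤ v → RawMonoid._∙_ M x u ≤ RawMonoid._∙_ M y v) where

  open RawMonoid M using (Carrier; _≈_) renaming (_∙_ to _+_; ε to 0#)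
  open RawMonoidOps M using (sum) renaming (_×_ to _·_)
  open IsCommutativeMonoid isCommutativeMonoid
    using (assoc; identityˡ; identityʳ; ∙-congˡ; ∙-congʳ)

  private
    commutativeMonoid : CommutativeMonoid a ℓ₁
    commutativeMonoid = record { isCommutativeMonoid = isCommutativeMonoid }

    preorder : Preorder a ℓ₁ ℓ₂
    preorder = record { isPreorder = isPreorder }

    module ≤ = IsPreorder isPreorder

  open Mult commutativeMonoid using (×-homo-+; ×-distrib-+; ×-congˡ)
  open PreorderReasoning preorder

  +-mono-≤ : _+_ Preserves₂ _≤_ ⟶ _≤_ ⟶ _≤_
  +-mono-≤ = +-mono _ _ _ _

  ·-zeroʳ : ∀ c → c · 0# ≈ 0#
  ·-zeroʳ zero    = ≤.Eq.refl
  ·-zeroʳ (suc c) = ≤.Eq.trans (identityˡ (c · 0#)) (·-zeroʳ c)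

  ·-distribˡ-sum : ∀ {m} c (p : Fin m → Carrier) → c · sum p ≈ sum (λ i → c · p i)
  ·-distribˡ-sum {zero}  c p = ·-zeroʳ c
  ·-distribˡ-sum {suc m} c p = ≤.Eq.trans (×-distrib-+ (p zero) (sum (p ∘ suc)) c)
    (∙-congˡ (·-distribˡ-sum c (p ∘ suc)))

  ·-monoʳ-≤ : ∀ c {x y} → x ≤ y → (c · x) ≤ (c · y)
  ·-monoʳ-≤ zero    x≤y = ≤.refl
  ·-monoʳ-≤ (suc c) x≤y = +-mono-≤ x≤y (·-monoʳ-≤ c x≤y)

  -- The slack e · x makes the induction on m go through: what a zero leaves
  -- unused of e + c is carried over to the remaining terms.
  chebyshev-slack : ∀ {m} (p : Fin m → Carrier) (a : Fin m → ℕ) c e x →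
    (∀ i j → i Fin.≤ j → p j ≤ p i) → (∀ i → 0# ≤ p i) →
    (∀ i j → i Fin.≤ j → a i ℕ.≤ a j) →
    0# ≤ x → (∀ i → p i ≤ x) → Counting.sum a ℕ.≤ e ℕ.+ m * c →
    sum (λ i → a i · p i) ≤ ((e · x) + sum (λ i → c · p i))
  chebyshev-slack {zero} p a c e x p↓ 0≤p a↑ 0≤x p≤x Σa≤ = begin
    0#            ≈⟨ ·-zeroʳ e ⟨
    e · 0#        ≲⟨ ·-monoʳ-≤ e 0≤x ⟩
    e · x         ≈⟨ identityʳ (e · x) ⟨
    (e · x) + 0#  ∎
  chebyshev-slack {suc m} p a c e x p↓ 0≤p a↑ 0≤x p≤x Σa≤ with a zero ℕ.≤? e ℕ.+ c
  ... | no a₀≰e+c = contradiction Σa≤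
    (ℕ.<⇒≱ (head-excess⇒sum-excess a c e a↑ (ℕ.≰⇒> a₀≰e+c)))
  ... | yes a₀≤e+c = begin
    (a₀ · p₀) + sum (λ i → a (suc i) · p (suc i))  ≲⟨ +-mono-≤ ≤.refl tail≤ ⟩
    (a₀ · p₀) + ((e′ · p₀) + S)  ≈⟨ assoc (a₀ · p₀) (e′ · p₀) S ⟨
    ((a₀ · p₀) + (e′ · p₀)) + S  ≈⟨ ∙-congʳ (×-homo-+ p₀ a₀ e′) ⟨
    ((a₀ ℕ.+ e′) · p₀) + S       ≈⟨ ∙-congʳ (×-congˡ a₀+e′≡e+c) ⟩
    ((e ℕ.+ c) · p₀) + S         ≈⟨ ∙-congʳ (×-homo-+ p₀ e c) ⟩
    ((e · p₀) + (c · p₀)) + S    ≈⟨ assoc (e · p₀) (c · p₀) S ⟩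
    -- The inherited slack is repriced from `p₀` up to `x`, which dominates every weight.
    (e · p₀) + ((c · p₀) + S)    ≲⟨ +-mono-≤ (·-monoʳ-≤ e (p≤x zero)) ≤.refl ⟩
    (e · x) + ((c · p₀) + S)     ∎
    where
    a₀ = a zero
    p₀ = p zero
    e′ = e ℕ.+ c ∸ a₀
    S = sum (λ i → c · p (suc i))
    a₀+e′≡e+c : a₀ ℕ.+ e′ ≡ e ℕ.+ c
    a₀+e′≡e+c = ℕ.m+[n∸m]≡n a₀≤e+c
    Σa⁺≤ : Counting.sum (a ∘ suc) ℕ.≤ e′ ℕ.+ m * c
    Σa⁺≤ = ℕ.+-cancelˡ-≤ a₀ _ _ (subst (a₀ ℕ.+ Counting.sum (a ∘ suc) ℕ.≤_)
      (trans (sym (ℕ.+-assoc e c (m * c)))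
        (trans (cong (ℕ._+ m * c) (sym a₀+e′≡e+c)) (ℕ.+-assoc a₀ e′ (m * c)))) Σa≤)
    tail≤ : sum (λ i → a (suc i) · p (suc i)) ≤ ((e′ · p₀) + S)
    tail≤ = chebyshev-slack (p ∘ suc) (a ∘ suc) c e′ p₀
      (λ i j i≤j → p↓ (suc i) (suc j) (ℕ.s≤s i≤j)) (0≤p ∘ suc)
      (λ i j i≤j → a↑ (suc i) (suc j) (ℕ.s≤s i≤j)) (0≤p zero)
      (λ i → p↓ zero (suc i) ℕ.z≤n) Σa⁺≤

  chebyshev : ∀ {m} (p : Fin m → Carrier) (a : Fin m → ℕ) c →
    (∀ i j → i Fin.≤ j → p j ≤ p i) → (∀ i → 0# ≤ p i) →
    (∀ i j → i Fin.≤ j → a i ℕ.≤ a j) → Counting.sum a ℕ.≤ m * c →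
    sum (λ i → a i · p i) ≤ (c · sum p)
  chebyshev {zero}  p a c p↓ 0≤p a↑ Σa≤ = ≤.reflexive (≤.Eq.sym (·-zeroʳ c))
  chebyshev {suc m} p a c p↓ 0≤p a↑ Σa≤ = begin
    sum (λ i → a i · p i)
      -- The induction starts without slack; `p zero`, the largest weight, serves as its price.
      ≲⟨ chebyshev-slack p a c 0 (p zero) p↓ 0≤p a↑ (0≤p zero) (λ i → p↓ zero i ℕ.z≤n) Σa≤ ⟩
    0# + sum (λ i → c · p i)    ≈⟨ identityˡ _ ⟩
    sum (λ i → c · p i)         ≈⟨ ·-distribˡ-sum c p ⟨
    c · sum p                   ∎

-- Order and addition of Cauchy reals.

open import Defs
open Counting
  using (Σcard-bound; card-mono; avoidingFirst; card-avoidingFirst; avoidingFirst-admissible)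

half-pos : ∀ {ε} → 0ℚ ℚ.< ε → 0ℚ ℚ.< ½ ℚ.* ε
half-pos {ε} 0<ε = subst (ℚ._< ½ ℚ.* ε) (ℚ.*-zeroʳ ½) (ℚ.*-monoʳ-<-pos ½ 0<ε)

q≤q+ε : ∀ q {ε} → 0ℚ ℚ.< ε → q ℚ.≤ q ℚ.+ ε
q≤q+ε q {ε} 0<ε = begin
  q         ≡⟨ ℚ.+-identityʳ q ⟨
  q ℚ.+ 0ℚ  ≤⟨ ℚ.+-monoʳ-≤ q (ℚ.<⇒≤ 0<ε) ⟩
  q ℚ.+ ε   ∎
  where open ℚ.≤-Reasoning

-- Through this the monoid laws are inherited termwise from the rationals.
≗⇒≃ : ∀ {x y} → seq x ≗ seq y → x ≃ y
≗⇒≃ {x} {y} x≗y ε 0<ε = 0 , λ n _ → subst (ℚ._≤ ε)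
  (sym (cong ℚ.∣_∣ (trans (cong (ℚ._- seq y n) (x≗y n)) (ℚ.+-inverseʳ (seq y n)))))
  (ℚ.<⇒≤ 0<ε)

≤-trans : ∀ {x y z} → x ≤ y → y ≤ z → x ≤ z
≤-trans {x} {y} {z} x≤y y≤z ε 0<ε
  with x≤y (½ ℚ.* ε) (half-pos 0<ε) | y≤z (½ ℚ.* ε) (half-pos 0<ε)
... | M , hx | N , hy = M ⊔ N , λ n M⊔N≤n → begin
  seq x n                           ≤⟨ hx n (ℕ.m⊔n≤o⇒m≤o M N M⊔N≤n) ⟩
  seq y n ℚ.+ δ                     ≤⟨ ℚ.+-monoˡ-≤ δ (hy n (ℕ.m⊔n≤o⇒n≤o M N M⊔N≤n)) ⟩
  seq z n ℚ.+ δ ℚ.+ δ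
    ≡⟨ solve 2 (λ q e → q :+ con ½ :* e :+ con ½ :* e := q :+ e) refl
         (seq z n) ε ⟩
  seq z n ℚ.+ ε                     ∎
  where open ℚ.≤-Reasoning
        open ℚ.+-*-Solver
        δ = ½ ℚ.* ε

+-mono-≤ : ∀ x y u v → x ≤ y → u ≤ v → x + u ≤ y + v
+-mono-≤ x y u v x≤y u≤v ε 0<ε
  with x≤y (½ ℚ.* ε) (half-pos 0<ε) | u≤v (½ ℚ.* ε) (half-pos 0<ε)
... | M , hx | N , hu = M ⊔ N , λ n M⊔N≤n → begin
  seq x n ℚ.+ seq u n
    ≤⟨ ℚ.+-mono-≤ (hx n (ℕ.m⊔n≤o⇒m≤o M N M⊔N≤n)) (hu n (ℕ.m⊔n≤o⇒n≤o M N M⊔N≤n)) ⟩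
  (seq y n ℚ.+ δ) ℚ.+ (seq v n ℚ.+ δ)
    ≡⟨ solve 3 (λ a b e → (a :+ con ½ :* e) :+ (b :+ con ½ :* e) := (a :+ b) :+ e) refl
         (seq y n) (seq v n) ε ⟩
  seq y n ℚ.+ seq v n ℚ.+ ε ∎
  where open ℚ.≤-Reasoning
        open ℚ.+-*-Solver
        δ = ½ ℚ.* ε

-- The two one-sided bounds together control the absolute value. Symmetry, transitivity and
-- congruence of `_≃_` are derived from the order in this way.
≤-antisym : ∀ {x y} → x ≤ y → y ≤ x → x ≃ y
≤-antisym {x} {y} x≤y y≤x ε 0<ε with x≤y ε 0<ε | y≤x ε 0<ε
... | M , hx | N , hy = M ⊔ N , λ n M⊔N≤n → abs-diff (seq x n) (seq y n)
  (hx n (ℕ.m⊔n≤o⇒m≤o M N M⊔N≤n)) (hy n (ℕ.m⊔n≤o⇒n≤o M N M⊔N≤n))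
  where
  open ℚ.≤-Reasoning
  open ℚ.+-*-Solver
  diff : ∀ p q → p ℚ.≤ q ℚ.+ ε → p ℚ.- q ℚ.≤ ε
  diff p q p≤q+ε = begin
    p ℚ.- q            ≤⟨ ℚ.+-monoˡ-≤ (ℚ.- q) p≤q+ε ⟩
    q ℚ.+ ε ℚ.- q      ≡⟨ solve 2 (λ q e → q :+ e :- q := e) refl q ε ⟩
    ε                  ∎
  abs-diff : ∀ p q → p ℚ.≤ q ℚ.+ ε → q ℚ.≤ p ℚ.+ ε → ℚ.∣ p ℚ.- q ∣ ℚ.≤ ε
  abs-diff p q p≤q+ε q≤p+ε with ℚ.∣p∣≡p∨∣p∣≡-p (p ℚ.- q)
  ... | inj₁ eq = subst (ℚ._≤ ε) (sym eq) (diff p q p≤q+ε)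
  ... | inj₂ eq = subst (ℚ._≤ ε)
    (sym (trans eq (solve 2 (λ p q → :- (p :- q) := q :- p) refl p q))) (diff q p q≤p+ε)

≃⇒≥ : ∀ {x y} → x ≃ y → y ≤ x
≃⇒≥ {x} {y} x≃y ε 0<ε with x≃y ε 0<ε
... | N , h = N , λ n N≤n → begin
  seq y n
    ≡⟨ solve 2 (λ a b → b := a :+ :- (a :- b)) refl (seq x n) (seq y n) ⟩
  seq x n ℚ.+ ℚ.- (seq x n ℚ.- seq y n)
    ≤⟨ ℚ.+-monoʳ-≤ (seq x n) (p≤∣p∣ _) ⟩
  seq x n ℚ.+ ℚ.∣ ℚ.- (seq x n ℚ.- seq y n) ∣
    ≡⟨ cong (seq x n ℚ.+_) (ℚ.∣-p∣≡∣p∣ _) ⟩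
  seq x n ℚ.+ ℚ.∣ seq x n ℚ.- seq y n ∣
    ≤⟨ ℚ.+-monoʳ-≤ (seq x n) (h n N≤n) ⟩
  seq x n ℚ.+ ε ∎
  where
  open ℚ.≤-Reasoning
  open ℚ.+-*-Solver
  p≤∣p∣ : ∀ p → p ℚ.≤ ℚ.∣ p ∣
  p≤∣p∣ p with ℚ.≤-total 0ℚ p
  ... | inj₁ 0≤p = ℚ.≤-reflexive (sym (ℚ.0≤p⇒∣p∣≡p 0≤p))
  ... | inj₂ p≤0 = ℚ.≤-trans p≤0 (ℚ.0≤∣p∣ p)

≃⇒≤ : ∀ {x y} → x ≃ y → x ≤ y
≃⇒≤ {x} {y} x≃y = ≃⇒≥ {y} {x} λ ε 0<ε → let N , h = x≃y ε 0<ε in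
  N , λ n N≤n → subst (ℚ._≤ ε)
    (trans (sym (ℚ.∣-p∣≡∣p∣ (seq x n ℚ.- seq y n)))
      (cong ℚ.∣_∣ (solve 2 (λ p q → :- (p :- q) := q :- p) refl (seq x n) (seq y n)))) (h n N≤n)
  where open ℚ.+-*-Solver

<⇒≤ : ∀ {x y} → x < y → x ≤ y
<⇒≤ {x} {y} (δ , 0<δ , N , h) ε 0<ε = N , λ n N≤n → begin
  seq x n        ≤⟨ q≤q+ε (seq x n) 0<δ ⟩
  seq x n ℚ.+ δ  ≤⟨ h n N≤n ⟩
  seq y n        ≤⟨ q≤q+ε (seq y n) 0<ε ⟩
  seq y n ℚ.+ ε  ∎
  where open ℚ.≤-Reasoning

+-0-isCommutativeMonoid : IsCommutativeMonoid _≃_ _+_ 0ℝ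
+-0-isCommutativeMonoid = record
  { isMonoid = record
    { isSemigroup = record
      { isMagma = record
        { isEquivalence = record
          { refl  = λ {x} → ≗⇒≃ {x} {x} λ _ → refl
          ; sym   = λ {x} {y} x≃y → ≤-antisym {y} {x} (≃⇒≥ {x} {y} x≃y) (≃⇒≤ {x} {y} x≃y)
          ; trans = λ {x} {y} {z} x≃y y≃z → ≤-antisym {x} {z}
              (≤-trans {x} {y} {z} (≃⇒≤ {x} {y} x≃y) (≃⇒≤ {y} {z} y≃z))
              (≤-trans {z} {y} {x} (≃⇒≥ {y} {z} y≃z) (≃⇒≥ {x} {y} x≃y))
          }
        ; ∙-cong = λ {x} {y} {u} {v} x≃y u≃v → ≤-antisym {x + u} {y + v}
            (+-mono-≤ x y u v (≃⇒≤ {x} {y} x≃y) (≃⇒≤ {u} {v} u≃v))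
            (+-mono-≤ y x v u (≃⇒≥ {x} {y} x≃y) (≃⇒≥ {u} {v} u≃v))
        }
      ; assoc = λ x y z → ≗⇒≃ {x + y + z} {x + (y + z)}
          λ n → ℚ.+-assoc (seq x n) (seq y n) (seq z n)
      }
    ; identity = (λ x → ≗⇒≃ {0ℝ + x} {x} λ n → ℚ.+-identityˡ (seq x n))
               , (λ x → ≗⇒≃ {x + 0ℝ} {x} λ n → ℚ.+-identityʳ (seq x n))
    }
  ; comm = λ x y → ≗⇒≃ {x + y} {y + x} λ n → ℚ.+-comm (seq x n) (seq y n)
  }

≤-isPreorder : IsPreorder _≃_ _≤_
≤-isPreorder = record
  { isEquivalence = IsCommutativeMonoid.isEquivalence +-0-isCommutativeMonoid
  ; reflexive     = λ {x} {y} → ≃⇒≤ {x} {y}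
  ; trans         = λ {x} {y} {z} → ≤-trans {x} {y} {z}
  }

module ℝ-Ordered =
  OrderedMonoid +-0-rawMonoid +-0-isCommutativeMonoid _≤_ ≤-isPreorder +-mono-≤

-- Attainment of the value, and the upper bound.

theorem1p5 : (k s : ℕ) → .{{NonZero k}} → .{{NonZero s}} →
    (p : Fin (suc s) → ℝ) →
    (∀ i j → i Fin.≤ j → p j ≤ p i) →
    0ℝ < p (fromℕ s) →
    IsF (suc s * k) k s p (((suc s * k ∸ 1) C k) · sum p)
theorem1p5 k@(suc k′) s p p↓ 0<pₛ = attained , bounded
  where
  c = (suc s * k ∸ 1) C k

  attained : Σ[ 𝓑 ∈ (Fin (suc s) → Family (suc s * k)) ]
    Admissible (suc s * k) k s 𝓑 × weight p 𝓑 ≃ c · sum p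
  -- The chain is constant, and each family has `c` members because `suc s * k ∸ 1` computes to
  -- `k′ + s * k`.
  attained = (λ _ → avoidingFirst (k′ ℕ.+ s * k) k) , avoidingFirst-admissible k′ s ,
    subst (λ d → sum (λ i → d · p i) ≃ c · sum p) (sym (card-avoidingFirst (k′ ℕ.+ s * k) k))
      (IsCommutativeMonoid.sym +-0-isCommutativeMonoid {c · sum p} {sum (λ i → c · p i)}
        (ℝ-Ordered.·-distribˡ-sum c p))

  0≤p : ∀ i → 0ℝ ≤ p i
  -- The last weight is the smallest, so its positivity makes all weights nonnegative.
  0≤p i = ≤-trans {0ℝ} {p (fromℕ s)} {p i} (<⇒≤ {0ℝ} {p (fromℕ s)} 0<pₛ)
    (p↓ i (fromℕ s) (Fin.≤fromℕ i))

  bounded : ∀ v → Σ[ 𝓑 ∈ (Fin (suc s) → Family (suc s * k)) ]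
    (Admissible (suc s * k) k s 𝓑 × weight p 𝓑 ≃ v) → v ≤ c · sum p
  bounded v (𝓑 , admissible , weight≃v) = ≤-trans {v} {weight p 𝓑} {c · sum p}
    (≃⇒≥ {weight p 𝓑} {v} weight≃v)
    -- Nesting makes the sizes increase while the weights decrease, and `Σcard-bound` says that the
    -- sizes average at most `c`.
    (ℝ-Ordered.chebyshev p (λ i → card (𝓑 i)) c p↓ 0≤p
      (λ i j i≤j → card-mono (𝓑 i) (𝓑 j) (nested i j i≤j))
      (Σcard-bound k s 𝓑 nested uniform no-rainbow))
    where
    open Admissible admissible
    no-rainbow : ¬ RainbowMatching 𝓑 (suc s)
    no-rainbow M = let ν , (_ , maximal) , ν≤s = overlapping in
      ℕ.<⇒≱ (ℕ.s≤s ν≤s) (maximal (suc s) M)
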